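{- Let $\Gamma=(N,A,u)$ be a finite normal form game with $N=\{1,\dots,n\}$ and $n\ge3$, in which every player has the same strategy set $X$, so $A=X^n$. The following are equivalent: (i) $\Gamma$ is fully symmetric (i.e. $u_i=u_{\pi(i)}\circ\pi$ for all $i\in N$ and $\pi\in S_N$) and $u_i=u_j$ for all $i,j\in N$; (ii) for each $i\in N$ and $\pi\in S_N$, $u_i=u_{\pi(i)}\circ\pi^{ -1}$.
   Context: For $\sigma\in S_N$ and $s\in A$ write $\sigma(s)=(s_{\sigma^{ -1}(i)})_{i\in N}$, and for $f:A\to\mathbb{R}$, $f\circ\sigma$ denotes the map $s\mapsto f(\sigma(s))$. $u_i:A\to\mathbb{R}$ is the utility function of player $i$. -}

module Defs where

open import Data.Nat.Base as ℕ using (ℕ; _⊔_)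
import Data.Nat.Properties as ℕ
open import Data.Rational.Base using (ℚ; 0ℚ; 1ℚ; ½; _+_; _*_; _-_; ∣_∣; _<_)
open import Data.Rational.Properties
open import Data.Rational.Solver using (module +-*-Solver)
open import Data.Fin.Base using (Fin)
open import Data.Fin.Permutation using (Permutation′; _⟨$⟩ʳ_; _⟨$⟩ˡ_)
open import Data.Product.Base using (∃-syntax; _,_)
open import Data.Vec.Base using (Vec; lookup; tabulate)
open import Function.Bundles using (_↔_)
open import Relation.Binary.Structures using (IsEquivalence)
open import Relation.Binary.PropositionalEquality using (_≡_; refl; sym; trans; cong; subst)

-- Real numbers as Cauchy sequences of rationals.  There are no quotient
-- types, so equality of reals is the relation _≈_: the difference of the two
-- sequences tends to zero.

record ℝ : Set where
  field
    seq    : ℕ → ℚ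
    cauchy : ∀ ε → 0ℚ < ε →
             ∃[ K ] (∀ k l → K ℕ.≤ k → K ℕ.≤ l → ∣ seq k - seq l ∣ < ε)

open ℝ public

infix 4 _≈_

_≈_ : ℝ → ℝ → Set
x ≈ y = ∀ ε → 0ℚ < ε → ∃[ K ] (∀ k → K ℕ.≤ k → ∣ seq x k - seq y k ∣ < ε)

≈-refl : ∀ {x} → x ≈ x
≈-refl {x} ε 0<ε =
  0 , λ k _ → subst (_< ε) (cong ∣_∣ (sym (+-inverseʳ (seq x k)))) 0<ε

≈-sym : ∀ {x y} → x ≈ y → y ≈ x
≈-sym {x} {y} x≈y ε 0<ε with x≈y ε 0<ε
... | K , bound = K , λ k K≤k → subst (_< ε) (swap (seq x k) (seq y k)) (bound k K≤k)
  where
  open +-*-Solver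
  swap : ∀ p q → ∣ p - q ∣ ≡ ∣ q - p ∣
  swap p q = trans (sym (∣-p∣≡∣p∣ (p - q)))
    (cong ∣_∣ (solve 2 (λ a b → :- (a :- b) := b :- a) refl p q))

≈-trans : ∀ {x y z} → x ≈ y → y ≈ z → x ≈ z
≈-trans {x} {y} {z} x≈y y≈z ε 0<ε with x≈y (½ * ε) 0<½ε | y≈z (½ * ε) 0<½ε
  where
  0<½ε : 0ℚ < ½ * ε
  0<½ε = subst (_< ½ * ε) (*-zeroʳ ½) (*-monoʳ-<-pos ½ 0<ε)
... | K , boundK | L , boundL = K ⊔ L , λ k K⊔L≤k → begin-strict
    ∣ seq x k - seq z k ∣
      ≡⟨ cong ∣_∣ (split (seq x k) (seq y k) (seq z k)) ⟩
    ∣ (seq x k - seq y k) + (seq y k - seq z k) ∣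
      ≤⟨ ∣p+q∣≤∣p∣+∣q∣ (seq x k - seq y k) (seq y k - seq z k) ⟩
    ∣ seq x k - seq y k ∣ + ∣ seq y k - seq z k ∣
      <⟨ +-mono-< (boundK k (ℕ.≤-trans (ℕ.m≤m⊔n K L) K⊔L≤k))
                  (boundL k (ℕ.≤-trans (ℕ.m≤n⊔m K L) K⊔L≤k)) ⟩
    ½ * ε + ½ * ε
      ≡⟨ sym (*-distribʳ-+ ε ½ ½) ⟩
    1ℚ * ε
      ≡⟨ *-identityˡ ε ⟩
    ε ∎
  where
  open ≤-Reasoning
  open +-*-Solver
  split : ∀ p q r → p - r ≡ (p - q) + (q - r)
  split = solve 3 (λ a b c → a :- c := (a :- b) :+ (b :- c)) refl

≈-isEquivalence : IsEquivalence _≈_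
≈-isEquivalence = record
  { refl  = λ {x} → ≈-refl {x}
  ; sym   = λ {x} {y} → ≈-sym {x} {y}
  ; trans = λ {x} {y} {z} → ≈-trans {x} {y} {z}
  }

-- Profiles are vectors rather than functions Fin n → X, so that propositional
-- equality of profiles is componentwise equality without function
-- extensionality, and every map on profiles respects it.
Profile : ℕ → Set → Set
Profile n X = Vec X n

record Game (n : ℕ) : Set₁ where
  field
    X      : Set
    size   : ℕ
    finite : X ↔ Fin size
    u      : Fin n → Profile n X → ℝ

module _ {n : ℕ} {X : Set} where

  act : Permutation′ n → Profile n X → Profile n X
  act σ s = tabulate (λ i → lookup s (σ ⟨$⟩ˡ i))

  infixl 9 _∘ₐ_
  _∘ₐ_ : (Profile n X → ℝ) → Permutation′ n → (Profile n X → ℝ)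
  (f ∘ₐ σ) s = f (act σ s)

  infix 4 _≐_
  _≐_ : (Profile n X → ℝ) → (Profile n X → ℝ) → Set
  f ≐ g = ∀ s → f s ≈ g s

FullySymmetric : ∀ {n} → Game n → Set
FullySymmetric {n} Γ = ∀ (i : Fin n) (π : Permutation′ n) → u i ≐ u (π ⟨$⟩ʳ i) ∘ₐ π
  where open Game Γ

{-# OPTIONS --safe #-}

-- Condition (ii) couples two actions of opposite variance:
-- s ↦ π⁻¹(s) is a right action while i ↦ π(i) is a left one.
-- Applying (ii) to π and then to σ, and comparing with (ii) for π ∘ σ, gives
-- u_{σ(π(i))} = u_{π(σ(i))}.  For j ≠ k pick i different from both (n ≥ 3) and
-- take π = (i j), σ = (i k): then σ(π(i)) = j and π(σ(i)) = k, so u_j = u_k.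
-- Once all utilities agree, the two invariance conditions differ only by
-- replacing π with π⁻¹.

module Submission where

open import Defs
open import Data.Nat.Base using (ℕ; _≤_; s≤s)
open import Data.Fin.Base using (Fin; zero; suc)
open import Data.Fin.Properties using (_≟_)
open import Data.Fin.Permutation using (Permutation′; _⟨$⟩ʳ_; _⟨$⟩ˡ_; flip; _∘ₚ_; transpose; inverseˡ)
open import Data.Product.Base using (_×_; ∃-syntax; _,_)
open import Data.Vec.Base using (lookup)
open import Data.Vec.Properties using (lookup∘tabulate; tabulate∘lookup; tabulate-cong)
open import Function.Base using (_∘_)
open import Function.Bundles using (_⇔_; mk⇔)
open import Relation.Binary.Bundles using (Setoid)
open import Relation.Binary.PropositionalEquality using (_≡_; _≢_; refl; sym; trans; cong; subst₂)
import Relation.Binary.Reasoning.Setoid as ≈-Reasoning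
open import Relation.Nullary using (yes; no)
open import Relation.Nullary.Decidable using (dec-true; dec-false)

≈-setoid : Setoid _ _
≈-setoid = record { isEquivalence = ≈-isEquivalence }

module _ {n : ℕ} {X : Set} where

  -- `∘ₚ` applies its left factor first, so the inverse of `σ ∘ₚ τ` undoes `τ` before `σ`, as the
  -- nested lookups do.
  act-∘ : ∀ (σ τ : Permutation′ n) (s : Profile n X) → act τ (act σ s) ≡ act (σ ∘ₚ τ) s
  act-∘ σ τ s = tabulate-cong λ i → lookup∘tabulate (λ k → lookup s (σ ⟨$⟩ˡ k)) (τ ⟨$⟩ˡ i)

  act-flip-act : ∀ (σ : Permutation′ n) (s : Profile n X) → act (flip σ) (act σ s) ≡ s
  act-flip-act σ s = trans (act-∘ σ (flip σ) s)
    (trans (tabulate-cong λ i → cong (lookup s) (inverseˡ σ)) (tabulate∘lookup s))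

transpose-first : ∀ {n} (i j : Fin n) → transpose i j ⟨$⟩ʳ i ≡ j
transpose-first i j rewrite dec-true (i ≟ i) refl = refl

transpose-fixes : ∀ {n} {i j k : Fin n} → k ≢ i → k ≢ j → transpose i j ⟨$⟩ʳ k ≡ k
transpose-fixes {i = i} {j} {k} k≢i k≢j
  rewrite dec-false (k ≟ i) k≢i | dec-false (k ≟ j) k≢j = refl

-- Two players cannot exhaust the first three, so the witness is always 0, 1 or 2.
third : ∀ {n} → 3 ≤ n → (j k : Fin n) → ∃[ i ] j ≢ i × k ≢ i
third (s≤s (s≤s (s≤s _))) zero          zero          = suc zero , (λ ()) , (λ ())
third (s≤s (s≤s (s≤s _))) zero          (suc zero)    = suc (suc zero) , (λ ()) , (λ ())
third (s≤s (s≤s (s≤s _))) zero          (suc (suc _)) = suc zero , (λ ()) , (λ ())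
third (s≤s (s≤s (s≤s _))) (suc zero)    zero          = suc (suc zero) , (λ ()) , (λ ())
third (s≤s (s≤s (s≤s _))) (suc (suc _)) zero          = suc zero , (λ ()) , (λ ())
third (s≤s (s≤s (s≤s _))) (suc _)       (suc _)       = zero , (λ ()) , (λ ())

module _ {n : ℕ} (Γ : Game n) where
  open Game Γ
  open ≈-Reasoning ≈-setoid

  InverseSymmetric : Set
  InverseSymmetric = ∀ (i : Fin n) (π : Permutation′ n) → u i ≐ u (π ⟨$⟩ʳ i) ∘ₐ flip π

  CommonUtility : Set
  CommonUtility = ∀ (i j : Fin n) → u i ≐ u j

  -- Both sides equal `u i s`, reached by `π` then `σ`, or by `σ ∘ₚ π` at once. The two routes
  -- permute the profile alike but move the player in opposite orders.
  inverseSymmetric⇒commute : InverseSymmetric → ∀ (π σ : Permutation′ n) i →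
    u (σ ⟨$⟩ʳ (π ⟨$⟩ʳ i)) ≐ u (π ⟨$⟩ʳ (σ ⟨$⟩ʳ i))
  inverseSymmetric⇒commute inv π σ i t = begin
    u (σ ⟨$⟩ʳ (π ⟨$⟩ʳ i)) t                              ≡⟨ cong (u _) s↦t ⟨
    -- `flip (σ ∘ₚ π)` and `flip π ∘ₚ flip σ` look up the same entries by computation.
    u (σ ⟨$⟩ʳ (π ⟨$⟩ʳ i)) (act (flip (σ ∘ₚ π)) s)        ≡⟨ cong (u _) (act-∘ (flip π) (flip σ) s) ⟨
    u (σ ⟨$⟩ʳ (π ⟨$⟩ʳ i)) (act (flip σ) (act (flip π) s)) ≈⟨ inv (π ⟨$⟩ʳ i) σ (act (flip π) s) ⟨
    u (π ⟨$⟩ʳ i) (act (flip π) s)                        ≈⟨ inv i π s ⟨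
    u i s                                                ≈⟨ inv i (σ ∘ₚ π) s ⟩
    u (π ⟨$⟩ʳ (σ ⟨$⟩ʳ i)) (act (flip (σ ∘ₚ π)) s)        ≡⟨ cong (u _) s↦t ⟩
    u (π ⟨$⟩ʳ (σ ⟨$⟩ʳ i)) t                              ∎
    where
    -- The preimage of `t`, so that both routes end at the arbitrary profile `t`.
    s = act (σ ∘ₚ π) t
    s↦t : act (flip (σ ∘ₚ π)) s ≡ t
    s↦t = act-flip-act (σ ∘ₚ π) t

  inverseSymmetric⇒commonUtility : 3 ≤ n → InverseSymmetric → CommonUtility
  inverseSymmetric⇒commonUtility 3≤n inv j k with j ≟ k
  ... | yes refl = λ s → Setoid.refl ≈-setoid {u j s}
  ... | no j≢k with third 3≤n j k
  ...   | i , j≢i , k≢i = subst₂ (λ a b → u a ≐ u b) σπi≡j πσi≡k (inverseSymmetric⇒commute inv π σ i)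
    where
    π = transpose i j
    σ = transpose i k
    -- Each transposition moves `i` to its own target, which the other one fixes.
    σπi≡j : σ ⟨$⟩ʳ (π ⟨$⟩ʳ i) ≡ j
    σπi≡j = trans (cong (σ ⟨$⟩ʳ_) (transpose-first i j)) (transpose-fixes j≢i j≢k)
    πσi≡k : π ⟨$⟩ʳ (σ ⟨$⟩ʳ i) ≡ k
    πσi≡k = trans (cong (π ⟨$⟩ʳ_) (transpose-first i k)) (transpose-fixes k≢i (j≢k ∘ sym))

  commonUtility⇒fullySymmetric : CommonUtility → InverseSymmetric → FullySymmetric Γ
  commonUtility⇒fullySymmetric common inv i π s = begin
    -- `act (flip (flip π))` computes to `act π`; only the player index, the preimage of `i`, is
    -- left to correct.
    u i s                             ≈⟨ inv i (flip π) s ⟩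
    u (flip π ⟨$⟩ʳ i) (act π s)       ≈⟨ common (flip π ⟨$⟩ʳ i) (π ⟨$⟩ʳ i) (act π s) ⟩
    u (π ⟨$⟩ʳ i) (act π s)            ∎

  commonUtility⇒inverseSymmetric : CommonUtility → FullySymmetric Γ → InverseSymmetric
  commonUtility⇒inverseSymmetric common sym′ i π s = begin
    u i s                             ≈⟨ sym′ i (flip π) s ⟩
    u (flip π ⟨$⟩ʳ i) (act (flip π) s) ≈⟨ common (flip π ⟨$⟩ʳ i) (π ⟨$⟩ʳ i) (act (flip π) s) ⟩
    u (π ⟨$⟩ʳ i) (act (flip π) s)     ∎

theorem3p18 : (n : ℕ) → 3 ≤ n → (Γ : Game n) → let open Game Γ in
    (FullySymmetric Γ × (∀ (i j : Fin n) → u i ≐ u j))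
    ⇔ (∀ (i : Fin n) (π : Permutation′ n) → u i ≐ u (π ⟨$⟩ʳ i) ∘ₐ flip π)
theorem3p18 n 3≤n Γ = mk⇔
  (λ (full , common) → commonUtility⇒inverseSymmetric Γ common full)
  (λ inv → let common = inverseSymmetric⇒commonUtility Γ 3≤n inv in
    commonUtility⇒fullySymmetric Γ common inv , common)
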